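{- Let $n\ge 3$ and $m\ge 5$ be integers and let $G_{n,m}$ be the grid graph with $n$ rows and $m$ columns. Then $\mathrm{mpd}(G_{n,m})=4$.
   Context: The grid graph $G_{n,m}$ has vertex set $\{(x,y):1\le x\le n,\ 1\le y\le m\}$, with $(x,y)$ and $(x',y')$ adjacent if and only if $|x-x'|+|y-y'|=1$. $d(u,v)$ denotes the shortest-path distance. Let $G$ be a connected graph and let $\Pi=\{S_1,\dots,S_t\}$ be a partition of $V(G)$ into nonempty parts. For $v\in V(G)$ put $d(v,S_i)=\min\{d(v,x):x\in S_i\}$. The multiset partition representation of $v$ with respect to $\Pi$ is the multiset $r_{mp}(v\mid\Pi)=\{d(v,S_1),\dots,d(v,S_t)\}$ (order ignored, multiplicities kept). $\Pi$ is a resolving multiset partition if $r_{mp}(u\mid\Pi)\ne r_{mp}(v\mid\Pi)$ for all distinct $u,v\in V(G)$. The multiset partition dimension $\mathrm{mpd}(G)$ is the minimum number $t$ of parts of a resolving multiset partition of $G$, and $\mathrm{mpd}(G)=\infty$ if none exists. -}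

module Defs where

open import Data.Fin.Base using (Fin; toℕ)
open import Data.List.Base using (List; tabulate)
open import Data.List.Relation.Binary.Permutation.Propositional using (_↭_)
open import Data.Nat.Base using (ℕ; zero; suc; _+_; _≤_; ∣_-_∣)
open import Data.Nat.Properties using (∣-∣-comm; ∣n-n∣≡0)
open import Data.Product.Base using (∃; _×_; _,_)
open import Level using (Level; 0ℓ)
open import Relation.Binary.Core using (Rel)
open import Relation.Binary.Definitions using (Symmetric; Irreflexive)
open import Relation.Binary.PropositionalEquality
  using (_≡_; _≢_; refl; sym; trans; cong₂)
open import Relation.Nullary.Construct.Add.Supremum using (_⁺; ⊤⁺; [_])
open import Relation.Nullary.Negation.Core using (¬_)
open import Relation.Unary using (Pred; _∈_; _⊥_; Satisfiable)

private
  variable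
    ℓ : Level

IsMinimum : Pred ℕ ℓ → Pred ℕ ℓ
IsMinimum P k = k ∈ P × (∀ j → j ∈ P → k ≤ j)

record Graph : Set₁ where
  field
    Vertex   : Set
    Adjacent : Rel Vertex 0ℓ
    symm     : Symmetric Adjacent
    irrefl   : Irreflexive _≡_ Adjacent

record Partition (A : Set) (t : ℕ) : Set₁ where
  field
    part     : Fin t → Pred A 0ℓ
    nonempty : ∀ i → Satisfiable (part i)
    disjoint : ∀ i j → i ≢ j → part i ⊥ part j
    cover    : ∀ x → ∃ λ i → x ∈ part i

module _ (G : Graph) where
  open Graph G

  data Walk : Vertex → Vertex → ℕ → Set where
    []  : ∀ {u} → Walk u u zero
    _∷_ : ∀ {u v w k} → Adjacent u v → Walk v w k → Walk u w (suc k)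

  -- Distance u v k means d(u,v) = k.  A shortest walk never repeats a
  -- vertex, so this is also the length of a shortest path.
  Distance : Vertex → Vertex → Pred ℕ 0ℓ
  Distance u v = IsMinimum (Walk u v)

  -- DistanceToSet v S k means d(v,S) = k.
  DistanceToSet : Vertex → Pred Vertex 0ℓ → Pred ℕ 0ℓ
  DistanceToSet v S = IsMinimum (λ k → ∃ λ x → x ∈ S × Distance v x k)

  -- Since d is a relation here, the (unique) values d(v,Sᵢ) are part of the
  -- data, so that a partition cannot be resolving merely because they are
  -- missing.  Multisets of naturals are lists up to permutation.
  record IsResolvingMultisetPartition {t} (Π : Partition Vertex t) : Set where
    open Partition Π
    field
      dist   : Vertex → Fin t → ℕ
      isDist : ∀ v i → DistanceToSet v (part i) (dist v i)

    rmp : Vertex → List ℕ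
    rmp v = tabulate (dist v)

    field
      resolves : ∀ u v → u ≢ v → ¬ (rmp u ↭ rmp v)

  HasResolvingMultisetPartition : Pred ℕ _
  HasResolvingMultisetPartition t =
    ∃ λ (Π : Partition Vertex t) → IsResolvingMultisetPartition Π

  -- IsMpd d means mpd(G) = d, where ⊤⁺ plays the role of ∞.
  IsMpd : Pred (ℕ ⁺) _
  IsMpd ⊤⁺    = ∀ t → ¬ HasResolvingMultisetPartition t
  IsMpd [ t ] = IsMinimum HasResolvingMultisetPartition t

-- Coordinates run from 0 instead of 1; adjacency only sees differences.
grid : ℕ → ℕ → Graph
grid n m = record
  { Vertex   = Fin n × Fin m
  ; Adjacent = λ (x , y) (x′ , y′) →
      ∣ toℕ x - toℕ x′ ∣ + ∣ toℕ y - toℕ y′ ∣ ≡ 1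
  ; symm     = λ {(x , y)} {(x′ , y′)} e →
      trans (cong₂ _+_ (∣-∣-comm (toℕ x′) (toℕ x)) (∣-∣-comm (toℕ y′) (toℕ y))) e
  ; irrefl   = λ { {x , y} refl e → 0≢1 (trans (sym (cong₂ _+_ (∣n-n∣≡0 (toℕ x)) (∣n-n∣≡0 (toℕ y)))) e) }
  }
  where
  0≢1 : 0 ≢ 1
  0≢1 ()

{-# OPTIONS --safe #-}

-- Lower bound (for any graph): if i, j, k are the three parts, a vertex of part i
-- adjacent to part j has representation {0,1,a} with a its distance to part k.
-- If a = 1, the vertex and a neighbour in each of the other two parts are three vertices
-- with a ∈ {1,2}, so two representations agree.  If a > 1, the last vertex before part k
-- on a shortest walk to part k is again of this kind with value at most a, and not a itself
-- since the partition is resolving: descend to a = 1.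
--
-- Upper bound: three landmarks P, Q, R as singleton parts, and all other vertices as the
-- fourth part.  P lies in the colour class of the checkerboard opposite to that of Q and R,
-- so parity singles out d(v,P) in the multiset, leaving {d(v,Q), d(v,R)} unordered.
-- With m columns take Q = (0,0) and P = (0,1), R = (0,m-1) if m is odd,
-- P = (0,m-1), R = (2,0) if m is even.
module Submission where

open import Defs
import Algebra.Properties.CommutativeSemigroup
open import Data.Empty using (⊥; ⊥-elim)
open import Data.Fin.Base using (Fin; zero; suc; toℕ; fromℕ; inject₁)
open import Data.Fin.Patterns using (0F; 1F; 2F)
open import Data.Fin.Properties
  using (all?; any?; toℕ-injective; toℕ-inject₁; toℕ-fromℕ; toℕ≤pred[n])
  renaming (_≟_ to _≟ᶠ_)
open import Data.List.Base using (List; []; _∷_; tabulate)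
open import Data.List.Relation.Binary.Permutation.Propositional
  using (_↭_; prep; swap; ↭-refl; ↭-sym; ↭-trans; ↭-reflexive; module PermutationReasoning)
open import Data.List.Relation.Binary.Permutation.Propositional.Properties
  using (shift; ↭-reverse; drop-∷; All-resp-↭; ∈-resp-↭; ↭-singleton-inv)
open import Data.List.Relation.Unary.All using (All; []; _∷_)
open import Data.List.Relation.Unary.Any using (here; there)
open import Data.Nat.Base
open import Data.Nat.Properties
open import Data.Nat.Solver using (module +-*-Solver)
open import Data.Parity.Base using (Parity; 0ℙ; 1ℙ; _⁻¹) renaming (_+_ to _⊕_)
import Data.Parity.Properties as ℙ
open import Data.Product.Base using (∃; -,_; _×_; _,_; proj₁; proj₂)
open import Data.Product.Properties using (≡-dec; ×-≡,≡→≡)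
open import Data.Sum.Base using (_⊎_; inj₁; inj₂)
open import Function.Definitions using (Injective)
open import Relation.Binary.Definitions using (DecidableEquality)
open import Relation.Binary.PropositionalEquality
  using (_≡_; _≢_; refl; sym; trans; cong; cong₂; subst; ≢-sym; module ≡-Reasoning)
open import Relation.Nullary.Construct.Add.Supremum using ([_])
open import Relation.Nullary.Decidable using (from-yes; ¬?; _→-dec_; _⊎-dec_; yes; no)
open import Relation.Nullary.Negation.Core using (¬_)
open import Relation.Unary using (Pred; _∈_)

-- Walks in a graph.

module _ (G : Graph) where
  open Graph G

  _++ʷ_ : ∀ {u v w k l} → Walk G u v k → Walk G v w l → Walk G u w (k + l)
  []      ++ʷ q = q
  (e ∷ p) ++ʷ q = e ∷ (p ++ʷ q)

  unsnoc : ∀ {u w k} → Walk G u w (suc k) → ∃ λ v → Walk G u v k × Adjacent v w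
  unsnoc (e ∷ [])          = _ , [] , e
  unsnoc (e ∷ p@(_ ∷ _)) with v , q , e′ ← unsnoc p = v , e ∷ q , e′

  reverseʷ : ∀ {u v k} → Walk G u v k → Walk G v u k
  reverseʷ []                = []
  reverseʷ {k = suc k} (e ∷ p) =
    subst (Walk G _ _) (+-comm k 1) (reverseʷ p ++ʷ (symm e ∷ []))

  adjacent⇒≢ : ∀ {u v} → Adjacent u v → u ≢ v
  adjacent⇒≢ e u≡v = irrefl u≡v e

-- Lets a representation be listed as own part, adjacent part, third part, whatever labels these
-- parts carry.
tabulate-↭-triple : (f : Fin 3 → ℕ) → ∀ i j k → i ≢ j → i ≢ k → j ≢ k →
                    tabulate f ↭ f i ∷ f j ∷ f k ∷ []
tabulate-↭-triple f 0F 0F _ i≢j _ _ = ⊥-elim (i≢j refl)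
tabulate-↭-triple f 0F _ 0F _ i≢k _ = ⊥-elim (i≢k refl)
tabulate-↭-triple f 0F 1F 1F _ _ j≢k = ⊥-elim (j≢k refl)
tabulate-↭-triple f 0F 2F 2F _ _ j≢k = ⊥-elim (j≢k refl)
tabulate-↭-triple f 0F 1F 2F _ _ _ = ↭-refl
tabulate-↭-triple f 0F 2F 1F _ _ _ = prep _ (swap _ _ ↭-refl)
tabulate-↭-triple f 1F 1F _ i≢j _ _ = ⊥-elim (i≢j refl)
tabulate-↭-triple f 1F _ 1F _ i≢k _ = ⊥-elim (i≢k refl)
tabulate-↭-triple f 1F 0F 0F _ _ j≢k = ⊥-elim (j≢k refl)
tabulate-↭-triple f 1F 2F 2F _ _ j≢k = ⊥-elim (j≢k refl)
tabulate-↭-triple f 1F 0F 2F _ _ _ = swap _ _ ↭-refl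
tabulate-↭-triple f 1F 2F 0F _ _ _ =
  ↭-trans (swap _ _ ↭-refl) (prep _ (swap _ _ ↭-refl))
tabulate-↭-triple f 2F 2F _ i≢j _ _ = ⊥-elim (i≢j refl)
tabulate-↭-triple f 2F _ 2F _ i≢k _ = ⊥-elim (i≢k refl)
tabulate-↭-triple f 2F 0F 0F _ _ j≢k = ⊥-elim (j≢k refl)
tabulate-↭-triple f 2F 1F 1F _ _ j≢k = ⊥-elim (j≢k refl)
tabulate-↭-triple f 2F 0F 1F _ _ _ =
  ↭-trans (prep _ (swap _ _ ↭-refl)) (swap _ _ ↭-refl)
tabulate-↭-triple f 2F 1F 0F _ _ _ =
  ↭-trans (swap _ _ ↭-refl) (↭-trans (prep _ (swap _ _ ↭-refl)) (swap _ _ ↭-refl))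

Fin3-exhausted : (i j k l : Fin 3) → i ≢ j → i ≢ k → j ≢ k → l ≡ i ⊎ l ≡ j ⊎ l ≡ k
Fin3-exhausted = from-yes (all? {n = 3} λ i → all? λ j → all? λ k → all? λ l →
  ¬? (i ≟ᶠ j) →-dec ¬? (i ≟ᶠ k) →-dec ¬? (j ≟ᶠ k) →-dec
  ((l ≟ᶠ i) ⊎-dec (l ≟ᶠ j) ⊎-dec (l ≟ᶠ k)))

1≤n≤2 : ∀ {n} → 1 ≤ n → n ≤ 2 → n ≡ 1 ⊎ n ≡ 2
1≤n≤2 {1} _ _ = inj₁ refl
1≤n≤2 {2} _ _ = inj₂ refl
1≤n≤2 {suc (suc (suc _))} _ (s≤s (s≤s ()))

-- Fewer than four parts never resolve.

module LowerBound (G : Graph) (d : Graph.Vertex G → Graph.Vertex G → ℕ)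
                  (isDistance : ∀ u v → Distance G u v (d u v)) where
  open Graph G

  module _ {t} (Π : Partition Vertex t) (R : IsResolvingMultisetPartition G Π) where
    open Partition Π
    open IsResolvingMultisetPartition R

    dist-≤ : ∀ {u x k} i → x ∈ part i → Walk G u x k → dist u i ≤ k
    dist-≤ {u} {x} i x∈i p = ≤-trans
      (proj₂ (isDist u i) (d u x) (x , x∈i , isDistance u x))
      (proj₂ (isDistance u x) _ p)

    nearest : ∀ u i → ∃ λ x → x ∈ part i × Walk G u x (dist u i)
    nearest u i with x , x∈i , p , _ ← proj₁ (isDist u i) = x , x∈i , p

    dist-self : ∀ {u} i → u ∈ part i → dist u i ≡ 0
    dist-self i u∈i = n≤0⇒n≡0 (dist-≤ i u∈i [])

    dist-positive : ∀ {u i} j → u ∈ part i → i ≢ j → 1 ≤ dist u j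
    dist-positive {u} {i} j u∈i i≢j with dist u j | nearest u j
    ... | zero  | _ , u∈j , [] = ⊥-elim (disjoint i j i≢j (u∈i , u∈j))
    ... | suc _ | _            = s≤s z≤n

    dist-Lipschitz : ∀ {u v k} j → Walk G u v k → dist u j ≤ k + dist v j
    dist-Lipschitz {v = v} j p with x , x∈j , q ← nearest v j = dist-≤ j x∈j (_++ʷ_ G p q)

    dist-adjacent : ∀ {u v i} j → u ∈ part i → i ≢ j → v ∈ part j → Adjacent u v →
                    dist u j ≡ 1
    dist-adjacent j u∈i i≢j v∈j e =
      ≤-antisym (dist-≤ j v∈j (e ∷ [])) (dist-positive j u∈i i≢j)

    neighbour-at-distance-1 : ∀ {u} j → dist u j ≡ 1 → ∃ λ v → v ∈ part j × Adjacent u v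
    neighbour-at-distance-1 {u} j eq with dist u j | nearest u j
    neighbour-at-distance-1 {u} j refl | _ | v , v∈j , (e ∷ []) = v , v∈j , e

    -- `r` is the last vertex before part `j` on a shortest walk from `u` to that part. If `r` were
    -- itself in part `j`, the walk of length `k` from `u` to `r` would already be too short.
    penultimate : ∀ {u i} j → u ∈ part i → i ≢ j →
      ∃ λ r → ∃ λ x → ∃ λ l → ∃ λ k →
        Walk G u r k × Adjacent r x × x ∈ part j × r ∈ part l × l ≢ j × dist u j ≡ suc k
    penultimate {u} {i} j u∈i i≢j
      with dist u j in eq | dist-positive {u} j u∈i i≢j | nearest u j
    ... | suc k | _ | x , x∈j , p with r , q , e ← unsnoc G p with l , r∈l ← cover r =
      r , x , l , k , q , e , x∈j , r∈l
        , (λ { refl → <-irrefl refl (≤-trans (≤-reflexive (sym eq)) (dist-≤ j r∈l q)) })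
        , refl

  -- Both ends of an edge between the two parts have representation {0, 1}.
  ¬resolving₂ : ¬ HasResolvingMultisetPartition G 2
  ¬resolving₂ (Π , R)
    with u , u∈0 ← Partition.nonempty Π zero
    with penultimate Π R (suc zero) u∈0 (λ ())
  ... | r , x , suc zero , _ , _ , _ , _ , _ , l≢1 , _ = l≢1 refl
  ... | r , x , zero , _ , _ , r~x , x∈1 , r∈0 , l≢1 , _ =
    IsResolvingMultisetPartition.resolves R r x (adjacent⇒≢ G r~x)
      (↭-trans (↭-reflexive (cong₂ _∷_ (dist-self Π R zero r∈0)
          (cong (_∷ []) (dist-adjacent Π R _ r∈0 (λ ()) x∈1 r~x))))
        (↭-trans (swap 0 1 ↭-refl)
          (↭-reflexive (sym (cong₂ _∷_ (dist-adjacent Π R zero x∈1 (λ ()) r∈0 (symm r~x))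
            (cong (_∷ []) (dist-self Π R (suc zero) x∈1)))))))

  module _ (Π : Partition Vertex 3) (R : IsResolvingMultisetPartition G Π) where
    open Partition Π
    open IsResolvingMultisetPartition R

    -- With `a` as an index, two boundary vertices of equal index have equal representations, even
    -- when their labels `i`, `j`, `k` differ.
    record Boundary (v : Vertex) (i j k : Fin 3) (a : ℕ) : Set where
      constructor boundary
      field
        i≢j   : i ≢ j
        i≢k   : i ≢ k
        j≢k   : j ≢ k
        v∈i   : v ∈ part i
        dist₁ : dist v j ≡ 1
        dist₂ : dist v k ≡ a

    rmp-boundary : ∀ {v i j k a} → Boundary v i j k a → rmp v ↭ 0 ∷ 1 ∷ a ∷ []
    rmp-boundary {v} {i} {j} {k} (boundary i≢j i≢k j≢k v∈i dvj dvk) = ↭-trans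
      (tabulate-↭-triple (dist v) i j k i≢j i≢k j≢k)
      (↭-reflexive (cong₂ _∷_ (dist-self Π R i v∈i) (cong₂ _∷_ dvj (cong (_∷ []) dvk))))

    boundary-unique : ∀ {u v i j k i′ j′ k′ a} →
      Boundary u i j k a → Boundary v i′ j′ k′ a → u ≢ v → ⊥
    boundary-unique b b′ u≢v =
      resolves _ _ u≢v (↭-trans (rmp-boundary b) (↭-sym (rmp-boundary b′)))

    -- The walk from `u` through `p` to `w` bounds `dist u k` and `dist w j` by 2. Both are
    -- positive, and the value 1 is already taken by `p`, so both would be 2.
    ¬boundary₁ : ∀ {p i j k} → ¬ Boundary p i j k 1
    ¬boundary₁ {p} {i} {j} {k} b@(boundary i≢j i≢k j≢k p∈i dpj dpk)
      with u , u∈j , p~u ← neighbour-at-distance-1 Π R j dpj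
         | w , w∈k , p~w ← neighbour-at-distance-1 Π R k dpk
      = pigeonhole
          (1≤n≤2 (dist-positive Π R k u∈j j≢k) (dist-≤ Π R k w∈k (symm p~u ∷ p~w ∷ [])))
          (1≤n≤2 (dist-positive Π R j w∈k (≢-sym j≢k)) (dist-≤ Π R j u∈j (symm p~w ∷ p~u ∷ [])))
      where
      bu : Boundary u j i k (dist u k)
      bu = boundary (≢-sym i≢j) j≢k i≢k u∈j
        (dist-adjacent Π R i u∈j (≢-sym i≢j) p∈i (symm p~u)) refl
      bw : Boundary w k i j (dist w j)
      bw = boundary (≢-sym i≢k) (≢-sym j≢k) i≢j w∈k
        (dist-adjacent Π R i w∈k (≢-sym i≢k) p∈i (symm p~w)) refl
      u≢w : u ≢ w
      u≢w refl = disjoint j k j≢k (u∈j , w∈k)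
      pigeonhole : dist u k ≡ 1 ⊎ dist u k ≡ 2 → dist w j ≡ 1 ⊎ dist w j ≡ 2 → ⊥
      pigeonhole (inj₁ eq) _ =
        boundary-unique b (subst (Boundary u j i k) eq bu) (adjacent⇒≢ G p~u)
      pigeonhole _ (inj₁ eq) =
        boundary-unique b (subst (Boundary w k i j) eq bw) (adjacent⇒≢ G p~w)
      pigeonhole (inj₂ eq) (inj₂ eq′) =
        boundary-unique (subst (Boundary u j i k) eq bu) (subst (Boundary w k i j) eq′ bw) u≢w

    -- `N` makes the descent on `a` structural. The vertex `r` is at distance 1 from part `k`, so
    -- its third part is `j` if `r` lies in part `i`, and `i` if `r` lies in part `j`.
    ¬boundary-< : ∀ N {p i j k a} → a < N → ¬ Boundary p i j k a
    ¬boundary-< (suc N) {p} {i} {j} {k} {a} (s≤s a≤N) b@(boundary i≢j i≢k j≢k p∈i dpj dpk)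
      with penultimate Π R k p∈i i≢k
    ... | r , x , l , zero , _ , _ , _ , _ , _ , eq =
      ¬boundary₁ (subst (Boundary p i j k) (trans (sym dpk) eq) b)
    ... | r , x , l , suc c , p⇝r , r~x , x∈k , r∈l , l≢k , eq =
      descend (Fin3-exhausted i j k l i≢j i≢k j≢k)
      where
      a≡2+c : a ≡ 2 + c
      a≡2+c = trans (sym dpk) eq
      1+c<N : suc c < N
      1+c<N = subst (_≤ N) a≡2+c a≤N
      drk : dist r k ≡ 1
      drk = dist-adjacent Π R k r∈l l≢k x∈k r~x
      p≢r : p ≢ r
      p≢r refl = 1+n≢0 (suc-injective (trans (sym eq) drk))
      drj≤a : dist r j ≤ a
      drj≤a = begin
        dist r j          ≤⟨ dist-Lipschitz Π R j (reverseʷ G p⇝r) ⟩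
        suc c + dist p j  ≡⟨ cong (suc c +_) dpj ⟩
        suc c + 1         ≡⟨ +-comm (suc c) 1 ⟩
        2 + c             ≡⟨ a≡2+c ⟨
        a                 ∎
        where open ≤-Reasoning
      descend : l ≡ i ⊎ l ≡ j ⊎ l ≡ k → ⊥
      -- The walk back to `p` and one further edge only give the bound `a` itself, so equality has
      -- to be excluded by uniqueness.
      descend (inj₁ refl) with m≤n⇒m<n∨m≡n drj≤a
      ... | inj₁ drj<a = ¬boundary-< N (<-≤-trans drj<a a≤N)
                           (boundary i≢k i≢j (≢-sym j≢k) r∈l drk refl)
      ... | inj₂ drj≡a = boundary-unique b
                           (boundary i≢k i≢j (≢-sym j≢k) r∈l drk drj≡a) p≢r
      -- Here `p` lies in the third part of `r`, and the walk back to `p` has length `suc c`, which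
      -- is less than `a`.
      descend (inj₂ (inj₁ refl)) =
        ¬boundary-< N (≤-<-trans (dist-≤ Π R i p∈i (reverseʷ G p⇝r)) 1+c<N)
          (boundary j≢k (≢-sym i≢j) (≢-sym i≢k) r∈l drk refl)
      descend (inj₂ (inj₂ l≡k)) = l≢k l≡k

    ¬boundary : ∀ {p i j k a} → ¬ Boundary p i j k a
    ¬boundary {a = a} = ¬boundary-< (suc a) ≤-refl

  -- A boundary vertex exists: the last vertex before part 1 on a shortest walk from part 0. It lies
  -- in part 0 or in part 2, and the other of these is its third part.
  ¬resolving₃ : ¬ HasResolvingMultisetPartition G 3
  ¬resolving₃ (Π , R)
    with u , u∈0 ← Partition.nonempty Π zero
    with penultimate Π R (suc zero) u∈0 (λ ())
  ... | r , x , zero , _ , _ , r~x , x∈1 , r∈l , l≢1 , _ =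
    ¬boundary Π R {k = suc (suc zero)} (boundary l≢1 (λ ()) (λ ()) r∈l
      (dist-adjacent Π R _ r∈l l≢1 x∈1 r~x) refl)
  ... | r , x , suc zero , _ , _ , _ , _ , _ , l≢1 , _ = l≢1 refl
  ... | r , x , suc (suc zero) , _ , _ , r~x , x∈1 , r∈l , l≢1 , _ =
    ¬boundary Π R {k = zero} (boundary l≢1 (λ ()) (λ ()) r∈l
      (dist-adjacent Π R _ r∈l l≢1 x∈1 r~x) refl)

  -- Two distinct vertices rule out a single part, where every representation is {0}.
  resolving⇒4≤ : ∀ {u v} → u ≢ v → ∀ t → HasResolvingMultisetPartition G t → 4 ≤ t
  resolving⇒4≤ {u} {v} u≢v 0 (Π , _) with () ← proj₁ (Partition.cover Π u)
  resolving⇒4≤ {u} {v} u≢v 1 (Π , R)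
    with zero , u∈0 ← Partition.cover Π u
    with zero , v∈0 ← Partition.cover Π v =
    ⊥-elim (IsResolvingMultisetPartition.resolves R u v u≢v
      (↭-reflexive (cong (_∷ []) (trans (dist-self Π R zero u∈0) (sym (dist-self Π R zero v∈0))))))
  resolving⇒4≤ u≢v 2 r = ⊥-elim (¬resolving₂ r)
  resolving⇒4≤ u≢v 3 r = ⊥-elim (¬resolving₃ r)
  resolving⇒4≤ u≢v (suc (suc (suc (suc t)))) _ = m≤m+n 4 t

-- Small multisets and parity.

pair-↭-inv : ∀ {a b c d : ℕ} → a ∷ b ∷ [] ↭ c ∷ d ∷ [] → a ≡ c × b ≡ d ⊎ a ≡ d × b ≡ c
pair-↭-inv {a} {b} {c} {d} p with ∈-resp-↭ p (here refl)
... | here refl with refl ← ↭-singleton-inv (drop-∷ p) = inj₁ (refl , refl)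
... | there (here refl)
  with refl ← ↭-singleton-inv (drop-∷ (↭-trans p (swap c d ↭-refl))) = inj₂ (refl , refl)

-- If `a` were `b′` or `c′`, the other of these two would be matched with `b` or `c`; but it has the
-- parity of `a`, against `a≁b`.
odd-one-out-↭ : ∀ {a b c a′ b′ c′} →
  parity b ≡ parity c → parity a ≢ parity b →
  parity b′ ≡ parity c′ → parity a′ ≢ parity b′ →
  a ∷ b ∷ c ∷ [] ↭ a′ ∷ b′ ∷ c′ ∷ [] → a ≡ a′ × b ∷ c ∷ [] ↭ b′ ∷ c′ ∷ []
odd-one-out-↭ {a} {b} {c} {a′} {b′} {c′} b~c a≁b b′~c′ a′≁b′ p with ∈-resp-↭ p (here refl)
... | here refl = refl , drop-∷ p
... | there (here refl)
  with ∈-resp-↭ (↭-sym (drop-∷ (↭-trans p (swap a′ b′ ↭-refl)))) (there (here refl))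
...   | here refl         = ⊥-elim (a≁b b′~c′)
...   | there (here refl) = ⊥-elim (a≁b (trans b′~c′ (sym b~c)))
odd-one-out-↭ {a} {b} {c} {a′} {b′} {c′} b~c a≁b b′~c′ a′≁b′ p | there (there (here refl))
  with ∈-resp-↭ (↭-sym (drop-∷ (↭-trans p (↭-trans (prep a′ (swap b′ c′ ↭-refl)) (swap a′ c′ ↭-refl)))))
         (there (here refl))
...   | here refl         = ⊥-elim (a≁b (sym b′~c′))
...   | there (here refl) = ⊥-elim (a≁b (trans (sym b′~c′) (sym b~c)))

≢⇒⊕≡1ℙ : ∀ {p q} → p ≢ q → p ⊕ q ≡ 1ℙ
≢⇒⊕≡1ℙ {0ℙ} {0ℙ} p≢q = ⊥-elim (p≢q refl)
≢⇒⊕≡1ℙ {0ℙ} {1ℙ} _   = refl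
≢⇒⊕≡1ℙ {1ℙ} {0ℙ} _   = refl
≢⇒⊕≡1ℙ {1ℙ} {1ℙ} p≢q = ⊥-elim (p≢q refl)

-- Singleton landmarks, with one further part for all other vertices.

module LandmarkPartition
  (G : Graph)
  (_≟_ : DecidableEquality (Graph.Vertex G))
  (d : Graph.Vertex G → Graph.Vertex G → ℕ)
  (isDistance : ∀ u v → Distance G u v (d u v))
  {k : ℕ} (ℓ : Fin (suc k) → Graph.Vertex G) (ℓ-injective : Injective _≡_ _≡_ ℓ)
  (escape : ∀ i → ∃ λ w → Graph.Adjacent G (ℓ i) w × (∀ j → w ≢ ℓ j))
  where

  open Graph G

  Outside : Pred Vertex _
  Outside v = ∀ i → v ≢ ℓ i

  landmarkPart : Fin (suc (suc k)) → Pred Vertex _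
  landmarkPart zero    v = Outside v
  landmarkPart (suc i) v = v ≡ ℓ i

  landmark-or-outside : ∀ v → (∃ λ i → v ≡ ℓ i) ⊎ Outside v
  landmark-or-outside v with any? (λ i → v ≟ ℓ i)
  ... | yes p = inj₁ p
  ... | no ¬p = inj₂ (λ i v≡ℓi → ¬p (i , v≡ℓi))

  landmarkPartition : Partition Vertex (suc (suc k))
  landmarkPartition = record
    { part     = landmarkPart
    ; nonempty = λ { zero → proj₁ (escape zero) , proj₂ (proj₂ (escape zero))
                   ; (suc i) → ℓ i , refl }
    ; disjoint = disjoint
    ; cover    = cover
    }
    where
    disjoint : ∀ i j → i ≢ j → ∀ {v} → ¬ (v ∈ landmarkPart i × v ∈ landmarkPart j)
    disjoint zero    zero    i≢j _            = i≢j refl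
    disjoint zero    (suc j) _   (out , eq)   = out j eq
    disjoint (suc i) zero    _   (eq , out)   = out i eq
    disjoint (suc i) (suc j) i≢j (refl , eq)  = i≢j (cong suc (ℓ-injective eq))
    cover : ∀ v → ∃ λ i → v ∈ landmarkPart i
    cover v with landmark-or-outside v
    ... | inj₁ (i , v≡ℓi) = suc i , v≡ℓi
    ... | inj₂ out        = zero , out

  -- By `escape` every landmark has a neighbour that is no landmark, which gives the value 1.
  dist : Vertex → Fin (suc (suc k)) → ℕ
  dist v (suc i) = d v (ℓ i)
  dist v zero with landmark-or-outside v
  ... | inj₁ _ = 1
  ... | inj₂ _ = 0

  dist-landmark : ∀ i → dist (ℓ i) zero ≡ 1
  dist-landmark i with landmark-or-outside (ℓ i)
  ... | inj₁ _   = refl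
  ... | inj₂ out = ⊥-elim (out i refl)

  dist-outside : ∀ {v} → Outside v → dist v zero ≡ 0
  dist-outside {v} out with landmark-or-outside v
  ... | inj₁ (i , v≡ℓi) = ⊥-elim (out i v≡ℓi)
  ... | inj₂ _          = refl

  isDist : ∀ v i → DistanceToSet G v (landmarkPart i) (dist v i)
  isDist v (suc i) = (ℓ i , refl , isDistance v (ℓ i))
    , λ { k (_ , refl , p , _) → proj₂ (isDistance v (ℓ i)) k p }
  isDist v zero with landmark-or-outside v
  ... | inj₂ out = (v , out , [] , λ _ _ → z≤n) , λ _ _ → z≤n
  ... | inj₁ (i , refl) with w , ℓ~w , out ← escape i =
    (w , out , (ℓ~w ∷ []) , λ k p → positive out p)
    , λ { k (x , x-out , p , _) → positive x-out p }
    where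
    positive : ∀ {x k} → Outside x → Walk G (ℓ i) x k → 1 ≤ k
    positive out []      = ⊥-elim (out i refl)
    positive out (_ ∷ _) = s≤s z≤n

-- Three landmarks in a bipartite graph.

module BipartiteLandmarks
  (G : Graph)
  (_≟_ : DecidableEquality (Graph.Vertex G))
  (d : Graph.Vertex G → Graph.Vertex G → ℕ)
  (isDistance : ∀ u v → Distance G u v (d u v))
  (d-self : ∀ v → d v v ≡ 0)
  (χ : Graph.Vertex G → Parity)
  (d-parity : ∀ u v → parity (d u v) ≡ χ u ⊕ χ v)
  (ℓ : Fin 3 → Graph.Vertex G)
  (escape : ∀ i → ∃ λ w → Graph.Adjacent G (ℓ i) w × (∀ j → w ≢ ℓ j))
  (χQ≡χR : χ (ℓ 1F) ≡ χ (ℓ 2F)) (χP≢χQ : χ (ℓ 0F) ≢ χ (ℓ 1F))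
  (Q≁R : d (ℓ 1F) (ℓ 0F) ≢ d (ℓ 2F) (ℓ 0F))
  -- Apart from the 0, the entries at `Q` are `d Q R`, which is even, and `d Q P` and 1, which are
  -- odd. A collision with `v` thus matches `d v P` with `d Q R`, and the remaining pairs with each
  -- other. The same holds at `R`.
  (outside≁Q : ∀ v → d v (ℓ 0F) ≡ d (ℓ 1F) (ℓ 2F) →
    ¬ (d v (ℓ 1F) ∷ d v (ℓ 2F) ∷ [] ↭ d (ℓ 1F) (ℓ 0F) ∷ 1 ∷ []))
  (outside≁R : ∀ v → d v (ℓ 0F) ≡ d (ℓ 2F) (ℓ 1F) →
    ¬ (d v (ℓ 1F) ∷ d v (ℓ 2F) ∷ [] ↭ d (ℓ 2F) (ℓ 0F) ∷ 1 ∷ []))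
  (outside-injective : ∀ u v → d u (ℓ 0F) ≡ d v (ℓ 0F) →
    d u (ℓ 1F) ∷ d u (ℓ 2F) ∷ [] ↭ d v (ℓ 1F) ∷ d v (ℓ 2F) ∷ [] → u ≡ v)
  where

  open Graph G

  P Q R : Vertex
  P = ℓ 0F
  Q = ℓ 1F
  R = ℓ 2F

  χP≢χR : χ P ≢ χ R
  χP≢χR eq = χP≢χQ (trans eq (sym χQ≡χR))

  P≢Q : P ≢ Q
  P≢Q eq = χP≢χQ (cong χ eq)

  P≢R : P ≢ R
  P≢R eq = χP≢χR (cong χ eq)

  Q≢R : Q ≢ R
  Q≢R eq = Q≁R (cong (λ v → d v P) eq)

  ℓ-injective : Injective _≡_ _≡_ ℓ
  ℓ-injective {0F} {0F} _  = refl
  ℓ-injective {0F} {1F} eq = ⊥-elim (P≢Q eq)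
  ℓ-injective {0F} {2F} eq = ⊥-elim (P≢R eq)
  ℓ-injective {1F} {0F} eq = ⊥-elim (P≢Q (sym eq))
  ℓ-injective {1F} {1F} _  = refl
  ℓ-injective {1F} {2F} eq = ⊥-elim (Q≢R eq)
  ℓ-injective {2F} {0F} eq = ⊥-elim (P≢R (sym eq))
  ℓ-injective {2F} {1F} eq = ⊥-elim (Q≢R (sym eq))
  ℓ-injective {2F} {2F} _  = refl

  open LandmarkPartition G _≟_ d isDistance ℓ ℓ-injective escape

  rmp : Vertex → List ℕ
  rmp v = tabulate (dist v)

  -- The nonzero entries of the representation, the one of singular parity first.
  data Signature : Vertex → ℕ → ℕ → ℕ → Set where
    atQ     : Signature Q (d Q R) (d Q P) 1
    atR     : Signature R (d R Q) (d R P) 1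
    outside : ∀ {v} → Outside v → Signature v (d v P) (d v Q) (d v R)

  signature : ∀ v → v ≡ P ⊎ ∃ λ a → ∃ λ b → ∃ λ c → Signature v a b c
  signature v with landmark-or-outside v
  ... | inj₁ (0F , v≡P)  = inj₁ v≡P
  ... | inj₁ (1F , refl) = inj₂ (-, -, -, atQ)
  ... | inj₁ (2F , refl) = inj₂ (-, -, -, atR)
  ... | inj₂ out         = inj₂ (-, -, -, outside out)

  parity-differs : ∀ v → parity (d v P) ≢ parity (d v Q)
  parity-differs v eq =
    χP≢χQ (ℙ.+-cancelˡ-≡ (χ v) _ _ (trans (sym (d-parity v P)) (trans eq (d-parity v Q))))

  d-odd : ∀ {u v} → χ u ≢ χ v → parity (d u v) ≡ 1ℙ
  d-odd {u} {v} χu≢χv = trans (d-parity u v) (≢⇒⊕≡1ℙ χu≢χv)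

  d-even : ∀ {u v} → χ u ≡ χ v → parity (d u v) ≡ 0ℙ
  d-even {u} {v} χu≡χv = trans (d-parity u v) (trans (cong (_⊕ χ v) χu≡χv) (ℙ.p+p≡0ℙ (χ v)))

  parity-≢ : ∀ {m n} → parity m ≡ 0ℙ → parity n ≡ 1ℙ → parity m ≢ parity n
  parity-≢ m-even n-odd eq with () ← trans (sym m-even) (trans eq n-odd)

  -- At `Q` and `R` the singular entry is the even distance between these two. At other vertices it
  -- is the distance to `P`, as `Q` and `R` share a colour that `P` does not have.
  signature-parity : ∀ {v a b c} → Signature v a b c → parity b ≡ parity c × parity a ≢ parity b
  signature-parity atQ = d-odd (≢-sym χP≢χQ) ,
    parity-≢ {d Q R} {d Q P} (d-even χQ≡χR) (d-odd (≢-sym χP≢χQ))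
  signature-parity atR = d-odd (≢-sym χP≢χR) ,
    parity-≢ {d R Q} {d R P} (d-even (sym χQ≡χR)) (d-odd (≢-sym χP≢χR))
  signature-parity (outside {v} _) =
    trans (d-parity v Q) (trans (cong (χ v ⊕_) χQ≡χR) (sym (d-parity v R))) , parity-differs v

  rmp-signature : ∀ {v a b c} → Signature v a b c → rmp v ↭ 0 ∷ a ∷ b ∷ c ∷ []
  rmp-signature atQ = begin
    rmp Q
      ≡⟨ cong₂ (λ x y → x ∷ d Q P ∷ y ∷ d Q R ∷ []) (dist-landmark 1F) (d-self Q) ⟩
    1 ∷ d Q P ∷ 0 ∷ d Q R ∷ []            ↭⟨ shift 0 (1 ∷ d Q P ∷ []) (d Q R ∷ []) ⟩
    0 ∷ 1 ∷ d Q P ∷ d Q R ∷ []            ↭⟨ prep 0 (↭-reverse (d Q R ∷ d Q P ∷ 1 ∷ [])) ⟩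
    0 ∷ d Q R ∷ d Q P ∷ 1 ∷ []            ∎
    where open PermutationReasoning
  rmp-signature atR = begin
    rmp R
      ≡⟨ cong₂ (λ x y → x ∷ d R P ∷ d R Q ∷ y ∷ []) (dist-landmark 2F) (d-self R) ⟩
    1 ∷ d R P ∷ d R Q ∷ 0 ∷ []            ↭⟨ ↭-reverse (0 ∷ d R Q ∷ d R P ∷ 1 ∷ []) ⟩
    0 ∷ d R Q ∷ d R P ∷ 1 ∷ []            ∎
    where open PermutationReasoning
  rmp-signature (outside {v} out) = ↭-reflexive (cong (_∷ d v P ∷ d v Q ∷ d v R ∷ []) (dist-outside out))

  rmp-P : rmp P ↭ 0 ∷ 1 ∷ d P Q ∷ d P R ∷ []
  rmp-P = ↭-trans (↭-reflexive (cong₂ (λ x y → x ∷ y ∷ d P Q ∷ d P R ∷ [])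
                                      (dist-landmark 0F) (d-self P)))
                  (swap 1 0 ↭-refl)

  signature-injective : ∀ {u v a b c a′ b′ c′} → Signature u a b c → Signature v a′ b′ c′ →
                        a ≡ a′ → b ∷ c ∷ [] ↭ b′ ∷ c′ ∷ [] → u ≡ v
  signature-injective atQ atQ _ _ = refl
  signature-injective atR atR _ _ = refl
  signature-injective atQ atR _ p with pair-↭-inv p
  ... | inj₁ (eq , _)   = ⊥-elim (Q≁R eq)
  ... | inj₂ (eq , eq′) = ⊥-elim (Q≁R (trans eq eq′))
  signature-injective atR atQ _ p with pair-↭-inv p
  ... | inj₁ (eq , _)   = ⊥-elim (Q≁R (sym eq))
  ... | inj₂ (eq , eq′) = ⊥-elim (Q≁R (sym (trans eq eq′)))
  signature-injective atQ (outside _) eq p = ⊥-elim (outside≁Q _ (sym eq) (↭-sym p))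
  signature-injective atR (outside _) eq p = ⊥-elim (outside≁R _ (sym eq) (↭-sym p))
  signature-injective (outside _) atQ eq p = ⊥-elim (outside≁Q _ eq p)
  signature-injective (outside _) atR eq p = ⊥-elim (outside≁R _ eq p)
  signature-injective (outside _) (outside _) eq p = outside-injective _ _ eq p

  -- The nonzero entries at P are all odd, while a signature has entries of both parities.
  rmp-P≁signature : ∀ {v a b c} → Signature v a b c → ¬ (rmp P ↭ rmp v)
  rmp-P≁signature sig p
    with all-odd ← All-resp-↭ {P = λ n → parity n ≡ 1ℙ}
                     (drop-∷ (↭-trans (↭-sym rmp-P) (↭-trans p (rmp-signature sig))))
                     (refl ∷ d-odd χP≢χQ ∷ d-odd χP≢χR ∷ [])
    with a-odd ∷ b-odd ∷ _ ← all-odd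
    = proj₂ (signature-parity sig) (trans a-odd (sym b-odd))

  resolves : ∀ u v → u ≢ v → ¬ (rmp u ↭ rmp v)
  resolves u v u≢v p with signature u | signature v
  ... | inj₁ refl | inj₁ refl = u≢v refl
  ... | inj₁ refl | inj₂ (_ , _ , _ , sig) = rmp-P≁signature sig p
  ... | inj₂ (_ , _ , _ , sig) | inj₁ refl = rmp-P≁signature sig (↭-sym p)
  ... | inj₂ (_ , _ , _ , sig) | inj₂ (_ , _ , _ , sig′)
    with b~c , a≁b ← signature-parity sig
    with b′~c′ , a′≁b′ ← signature-parity sig′
    with eq , q ← odd-one-out-↭ b~c a≁b b′~c′ a′≁b′
           (drop-∷ (↭-trans (↭-sym (rmp-signature sig)) (↭-trans p (rmp-signature sig′))))
    = u≢v (signature-injective sig sig′ eq q)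

  resolvable : HasResolvingMultisetPartition G 4
  resolvable = landmarkPartition , record { dist = dist ; isDist = isDist ; resolves = resolves }

-- Distance and checkerboard colouring of the grid.

step-towards : ∀ {n} (x x′ : Fin n) {k} → ∣ toℕ x′ - toℕ x ∣ ≡ suc k →
  ∃ λ (z : Fin n) → ∣ toℕ x - toℕ z ∣ ≡ 1 × ∣ toℕ x′ - toℕ z ∣ ≡ k
step-towards {suc (suc _)} zero (suc x′) eq =
  suc zero , refl , trans (∣-∣-identityʳ (toℕ x′)) (suc-injective eq)
-- The target is 0, so the step goes down: `inject₁ x` is the predecessor of `suc x` in the same
-- `Fin`.
step-towards (suc x) zero eq = inject₁ x
  , trans (cong (λ z → ∣ suc (toℕ x) - z ∣) (toℕ-inject₁ x)) (∣1+n-n∣≡1 (toℕ x))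
  , trans (toℕ-inject₁ x) (suc-injective eq)
  where
  ∣1+n-n∣≡1 : ∀ n → ∣ suc n - n ∣ ≡ 1
  ∣1+n-n∣≡1 zero    = refl
  ∣1+n-n∣≡1 (suc n) = ∣1+n-n∣≡1 n
step-towards (suc x) (suc x′) eq with z , p , q ← step-towards x x′ eq = suc z , p , q

parity-∣-∣ : ∀ m n → parity ∣ m - n ∣ ≡ parity m ⊕ parity n
parity-∣-∣ zero    n       = refl
parity-∣-∣ (suc m) zero    = sym (ℙ.+-identityʳ _)
parity-∣-∣ (suc m) (suc n) = begin
  parity ∣ m - n ∣                           ≡⟨ parity-∣-∣ m n ⟩
  parity m ⊕ parity n                        ≡⟨ cong₂ _⊕_ (ℙ.suc-homo-⁻¹ m) (ℙ.suc-homo-⁻¹ n) ⟨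
  parity (suc m) ⁻¹ ⊕ parity (suc n) ⁻¹      ≡⟨ p⁻¹+q⁻¹≡p+q (parity (suc m)) (parity (suc n)) ⟩
  parity (suc m) ⊕ parity (suc n)            ∎
  where
  open ≡-Reasoning
  p⁻¹+q⁻¹≡p+q : ∀ p q → p ⁻¹ ⊕ q ⁻¹ ≡ p ⊕ q
  p⁻¹+q⁻¹≡p+q 0ℙ 0ℙ = refl
  p⁻¹+q⁻¹≡p+q 0ℙ 1ℙ = refl
  p⁻¹+q⁻¹≡p+q 1ℙ 0ℙ = refl
  p⁻¹+q⁻¹≡p+q 1ℙ 1ℙ = refl

module _ (n m : ℕ) where

  open Graph (grid n m)

  -- Target minus source, so that distances to vertices with literal coordinates compute.
  manhattan : Vertex → Vertex → ℕ
  manhattan (x , y) (x′ , y′) = ∣ toℕ x′ - toℕ x ∣ + ∣ toℕ y′ - toℕ y ∣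

  manhattan-self : ∀ v → manhattan v v ≡ 0
  manhattan-self (x , y) = cong₂ _+_ (∣n-n∣≡0 (toℕ x)) (∣n-n∣≡0 (toℕ y))

  -- The first coordinate is adjusted before the second. Passing the two differences as `i` and `j`
  -- makes the recursion structural.
  manhattan-walk : ∀ i j {x y x′ y′} → ∣ toℕ x′ - toℕ x ∣ ≡ i → ∣ toℕ y′ - toℕ y ∣ ≡ j →
                   Walk (grid n m) (x , y) (x′ , y′) (i + j)
  manhattan-walk zero zero {x} {y} {x′} {y′} p q
    with refl ← toℕ-injective {i = x′} {j = x} (∣m-n∣≡0⇒m≡n p)
    with refl ← toℕ-injective {i = y′} {j = y} (∣m-n∣≡0⇒m≡n q) = []
  manhattan-walk zero (suc j) {x} {y} {y′ = y′} p q with z , r , s ← step-towards y y′ q =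
    cong₂ _+_ (∣n-n∣≡0 (toℕ x)) r ∷ manhattan-walk zero j p s
  manhattan-walk (suc i) j {x} {y} {x′} p q with z , r , s ← step-towards x x′ p =
    cong₂ _+_ r (∣n-n∣≡0 (toℕ y)) ∷ manhattan-walk i j s q

  manhattan-≤ : ∀ {u v k} → Walk (grid n m) u v k → manhattan u v ≤ k
  manhattan-≤ {u} [] = ≤-reflexive (manhattan-self u)
  manhattan-≤ {x , y} {x″ , y″} {suc k} (_∷_ {v = x′ , y′} e p) = begin
    ∣ toℕ x″ - toℕ x ∣ + ∣ toℕ y″ - toℕ y ∣
      ≤⟨ +-mono-≤ (∣-∣-triangle (toℕ x″) (toℕ x′) (toℕ x)) (∣-∣-triangle (toℕ y″) (toℕ y′) (toℕ y)) ⟩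
    (∣ toℕ x″ - toℕ x′ ∣ + ∣ toℕ x′ - toℕ x ∣) + (∣ toℕ y″ - toℕ y′ ∣ + ∣ toℕ y′ - toℕ y ∣)
      ≡⟨ medial ∣ toℕ x″ - toℕ x′ ∣ ∣ toℕ x′ - toℕ x ∣ ∣ toℕ y″ - toℕ y′ ∣ ∣ toℕ y′ - toℕ y ∣ ⟩
    (∣ toℕ x′ - toℕ x ∣ + ∣ toℕ y′ - toℕ y ∣) + manhattan (x′ , y′) (x″ , y″)
      -- Adjacency takes source minus target and `manhattan` target minus source; `symm` exchanges
      -- them.
      ≤⟨ +-mono-≤ (≤-reflexive (symm {x , y} {x′ , y′} e)) (manhattan-≤ p) ⟩
    1 + k ∎
    where
    open ≤-Reasoning
    medial : ∀ a b c d → (a + b) + (c + d) ≡ (b + d) + (a + c)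
    medial = solve 4 (λ a b c d → (a :+ b) :+ (c :+ d) := (b :+ d) :+ (a :+ c)) refl
      where open +-*-Solver

  manhattan-isDistance : ∀ u v → Distance (grid n m) u v (manhattan u v)
  manhattan-isDistance u v = manhattan-walk _ _ refl refl , λ _ p → manhattan-≤ p

  checkerboard : Vertex → Parity
  checkerboard (x , y) = parity (toℕ x + toℕ y)

  manhattan-parity : ∀ u v → parity (manhattan u v) ≡ checkerboard u ⊕ checkerboard v
  manhattan-parity (x , y) (x′ , y′) = begin
    parity (∣ toℕ x′ - toℕ x ∣ + ∣ toℕ y′ - toℕ y ∣)
      ≡⟨ ℙ.+-homo-+ ∣ toℕ x′ - toℕ x ∣ _ ⟩
    parity ∣ toℕ x′ - toℕ x ∣ ⊕ parity ∣ toℕ y′ - toℕ y ∣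
      ≡⟨ cong₂ _⊕_ (parity-∣-∣ (toℕ x′) (toℕ x)) (parity-∣-∣ (toℕ y′) (toℕ y)) ⟩
    (parity (toℕ x′) ⊕ parity (toℕ x)) ⊕ (parity (toℕ y′) ⊕ parity (toℕ y))
      ≡⟨ interchange (parity (toℕ x′)) _ _ _ ⟩
    (parity (toℕ x′) ⊕ parity (toℕ y′)) ⊕ (parity (toℕ x) ⊕ parity (toℕ y))
      ≡⟨ ℙ.+-comm (parity (toℕ x′) ⊕ parity (toℕ y′)) _ ⟩
    (parity (toℕ x) ⊕ parity (toℕ y)) ⊕ (parity (toℕ x′) ⊕ parity (toℕ y′))
      ≡⟨ cong₂ _⊕_ (ℙ.+-homo-+ (toℕ x) (toℕ y)) (ℙ.+-homo-+ (toℕ x′) (toℕ y′)) ⟨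
    checkerboard (x , y) ⊕ checkerboard (x′ , y′) ∎
    where
    open ≡-Reasoning
    open Algebra.Properties.CommutativeSemigroup
      ℙ.+-commutativeSemigroup using (interchange)

-- Arithmetic for recovering coordinates from distances.

pair-↭-sum : ∀ {a b c d} → a ∷ b ∷ [] ↭ c ∷ d ∷ [] → a + b ≡ c + d
pair-↭-sum {a} {b} p with pair-↭-inv p
... | inj₁ (refl , refl) = refl
... | inj₂ (refl , refl) = +-comm a b

∣m-n∣≤m+n : ∀ m n → ∣ m - n ∣ ≤ m + n
∣m-n∣≤m+n m n = ≤-trans (∣m-n∣≤m⊔n m n) (m⊔n≤m+n m n)

m+m≡n+n⇒m≡n : ∀ {m n} → m + m ≡ n + n → m ≡ n
m+m≡n+n⇒m≡n {m} {n} eq =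
  trans (n≡⌊n+n/2⌋ m) (trans (cong ⌊_/2⌋ eq) (sym (n≡⌊n+n/2⌋ n)))

-- Points equidistant from 1 coincide or are mirror images in 1, the column of `P` for odd width.
∣1-∣-fibre : ∀ m n → ∣ 1 - m ∣ ≡ ∣ 1 - n ∣ → m ≡ n ⊎ m + n ≡ 2
∣1-∣-fibre zero          zero          _  = inj₁ refl
∣1-∣-fibre zero          (suc n)       eq = inj₂ (cong suc (sym eq))
∣1-∣-fibre (suc m)       zero          eq = inj₂ (cong suc (trans (+-identityʳ m) eq))
∣1-∣-fibre (suc m)       (suc n)       eq = inj₁ (cong suc eq)

-- The value of `∣ 2 - n ∣ + n` is always at least 2, equals 2 at 1, and is 2n - 2 from 2 on. So
-- neither argument is 0; if one is 1, so is the other; and if both are at least 2, each would be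
-- smaller than the other. The number 2 is the row of `R` for even width.
∣2-∣-swap : ∀ m n → m + m ≡ ∣ 2 - n ∣ + n → n + n ≡ ∣ 2 - m ∣ + m → m ≡ n
∣2-∣-swap 0 n p _ with () ← ≤-trans (m≤∣m-n∣+n 2 n) (≤-reflexive (sym p))
∣2-∣-swap m@(suc _) 0 _ q with () ← ≤-trans (m≤∣m-n∣+n 2 m) (≤-reflexive (sym q))
∣2-∣-swap 1 n@(suc _) _ q = m+m≡n+n⇒m≡n (sym q)
∣2-∣-swap m@(suc (suc _)) 1 p _ = m+m≡n+n⇒m≡n p
∣2-∣-swap (suc (suc m)) (suc (suc n)) p q = ⊥-elim (<-irrefl refl (begin-strict
  m + (2 + m)        <⟨ +-monoˡ-< (2 + m) (m<n+m m {2} z<s) ⟩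
  (2 + m) + (2 + m)  ≡⟨ p ⟩
  n + (2 + n)        <⟨ +-monoˡ-< (2 + n) (m<n+m n {2} z<s) ⟩
  (2 + n) + (2 + n)  ≡⟨ q ⟩
  m + (2 + m)        ∎))
  where open ≤-Reasoning

-- Adds the two equations. In the applications `c` and `e` are the distances of a column to the two
-- outer columns; their sum is constant, so only row terms survive.
add-complementary : ∀ a a′ b b′ {c c′ e e′} → c + e ≡ c′ + e′ →
                    a + c ≡ b + c′ → a′ + e ≡ b′ + e′ → a + a′ ≡ b + b′
add-complementary a a′ b b′ {c} {c′} {e} {e′} ce ac ae = +-cancelʳ-≡ (c + e) _ _ (begin
  (a + a′) + (c + e)    ≡⟨ interchange a a′ c e ⟩
  (a + c) + (a′ + e)    ≡⟨ cong₂ _+_ ac ae ⟩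
  (b + c′) + (b′ + e′)  ≡⟨ interchange b c′ b′ e′ ⟩
  (b + b′) + (c′ + e′)  ≡⟨ cong ((b + b′) +_) ce ⟨
  (b + b′) + (c + e)    ∎)
  where
  open ≡-Reasoning
  open Algebra.Properties.CommutativeSemigroup +-commutativeSemigroup using (interchange)

-- Landmarks in the grid.

module LongGrid (n′ m′ : ℕ) where

  n m M : ℕ
  n = 3 + n′
  m = 5 + m′
  M = 4 + m′

  open Graph (grid n m)

  last : Fin m
  last = fromℕ M

  from-last : Fin m → ℕ
  from-last y = ∣ toℕ last - toℕ y ∣

  from-last-complement : ∀ y → toℕ y + from-last y ≡ toℕ last
  from-last-complement y = begin
    toℕ y + ∣ toℕ last - toℕ y ∣  ≡⟨ cong (toℕ y +_) (m≤n⇒∣n-m∣≡n∸m y≤last) ⟩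
    toℕ y + (toℕ last ∸ toℕ y)    ≡⟨ m+[n∸m]≡n y≤last ⟩
    toℕ last                      ∎
    where
    open ≡-Reasoning
    y≤last : toℕ y ≤ toℕ last
    y≤last = subst (toℕ y ≤_) (sym (toℕ-fromℕ M)) (toℕ≤pred[n] y)

  checkerboard-last : ∀ {p} → parity M ≡ p → parity (toℕ last) ≡ p
  checkerboard-last = trans (cong parity (toℕ-fromℕ M))

  -- All landmarks lie in rows 0 and 2, so row 1 contains none of them and is next to each.
  escape-to-row-1 : (ℓ : Fin 3 → Vertex) →
    (∀ i → ∣ toℕ (proj₁ (ℓ i)) - 1 ∣ ≡ 1) →
    ∀ i → ∃ λ w → Adjacent (ℓ i) w × (∀ j → w ≢ ℓ j)
  escape-to-row-1 ℓ near i =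
    (1F , proj₂ (ℓ i)) , cong₂ _+_ (near i) (∣n-n∣≡0 (toℕ (proj₂ (ℓ i)))) , outside
    where
    outside : ∀ j → (1F , proj₂ (ℓ i)) ≢ ℓ j
    outside j eq with () ← trans (cong (λ v → ∣ toℕ (proj₁ v) - 1 ∣) eq) (near j)

  -- Odd number of columns: the last column index `M` is even.

  module OddWidth (M-even : parity M ≡ 0ℙ) where

    ℓ : Fin 3 → Vertex
    ℓ 0F = 0F , 1F
    ℓ 1F = 0F , 0F
    ℓ 2F = 0F , last

    open ≤-Reasoning
    open Algebra.Properties.CommutativeSemigroup +-commutativeSemigroup using (interchange)

    outside≁Q : ∀ v → manhattan n m v (ℓ 0F) ≡ manhattan n m (ℓ 1F) (ℓ 2F) →
      ¬ (manhattan n m v (ℓ 1F) ∷ manhattan n m v (ℓ 2F) ∷ [] ↭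
         manhattan n m (ℓ 1F) (ℓ 0F) ∷ 1 ∷ [])
    -- The distances to the corners `Q` and `R` add up to 2x + M, at least 4, whereas the pair at
    -- `Q` is {1, 1}.
    outside≁Q (x , y) _ p with s≤s (s≤s ()) ← begin
      4                                           ≤⟨ m≤m+n 4 _ ⟩
      toℕ last                                    ≡⟨ from-last-complement y ⟨
      toℕ y + from-last y                         ≤⟨ m≤n+m _ (toℕ x + toℕ x) ⟩
      (toℕ x + toℕ x) + (toℕ y + from-last y)     ≡⟨ interchange (toℕ x) (toℕ x) (toℕ y) (from-last y) ⟩
      (toℕ x + toℕ y) + (toℕ x + from-last y)     ≡⟨ pair-↭-sum p ⟩
      2                                           ∎

    outside≁R : ∀ v → manhattan n m v (ℓ 0F) ≡ manhattan n m (ℓ 2F) (ℓ 1F) →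
      ¬ (manhattan n m v (ℓ 1F) ∷ manhattan n m v (ℓ 2F) ∷ [] ↭
         manhattan n m (ℓ 2F) (ℓ 0F) ∷ 1 ∷ [])
    -- The pair at `R` has sum (M - 1) + 1 = M, and 2x + M = M forces row 0. There the distance to
    -- `P` would be M, but no column is that far from column 1.
    outside≁R (x , y) eq p = too-far (toℕ y) (trans (cong (_+ ∣ 1 - toℕ y ∣) (sym x≡0)) eq)
      (≤-trans (m≤m+n (toℕ y) _) (≤-reflexive (from-last-complement y)))
      where
      double≤0 : (toℕ x + toℕ x) + toℕ last ≤ toℕ last
      double≤0 = begin
        (toℕ x + toℕ x) + toℕ last                ≡⟨ cong ((toℕ x + toℕ x) +_) (from-last-complement y) ⟨
        (toℕ x + toℕ x) + (toℕ y + from-last y)   ≡⟨ interchange (toℕ x) (toℕ x) (toℕ y) (from-last y) ⟩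
        (toℕ x + toℕ y) + (toℕ x + from-last y)   ≡⟨ pair-↭-sum p ⟩
        ∣ 1 - toℕ last ∣ + 1                      ≡⟨ +-comm ∣ 1 - toℕ last ∣ 1 ⟩
        toℕ last                                  ∎
      x≡0 : toℕ x ≡ 0
      x≡0 = m+n≡0⇒m≡0 (toℕ x) (n≤0⇒n≡0 (+-cancelʳ-≤ (toℕ last) _ 0 double≤0))
      too-far : ∀ c → ∣ 1 - c ∣ ≡ toℕ last → ¬ (c ≤ toℕ last)
      too-far (suc c) refl c<c = <-irrefl refl c<c

    outside-injective : ∀ u v → manhattan n m u (ℓ 0F) ≡ manhattan n m v (ℓ 0F) →
      manhattan n m u (ℓ 1F) ∷ manhattan n m u (ℓ 2F) ∷ [] ↭
      manhattan n m v (ℓ 1F) ∷ manhattan n m v (ℓ 2F) ∷ [] → u ≡ v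
    outside-injective (x , y) (x′ , y′) eq p = ×-≡,≡→≡ (x≡x′ , y≡y′)
      where
      complement-comm : from-last y′ + toℕ y′ ≡ toℕ last
      complement-comm = trans (+-comm (from-last y′) (toℕ y′)) (from-last-complement y′)
      -- The sum of the distances to `Q` and `R` ignores their order and determines the row.
      row : toℕ x + toℕ x ≡ toℕ x′ + toℕ x′
      row with pair-↭-inv p
      ... | inj₁ (ac , ae) = add-complementary (toℕ x) (toℕ x) (toℕ x′) (toℕ x′)
        (trans (from-last-complement y) (sym (from-last-complement y′))) ac ae
      ... | inj₂ (ac , ae) = add-complementary (toℕ x) (toℕ x) (toℕ x′) (toℕ x′)
        (trans (from-last-complement y) (sym complement-comm)) ac ae
      x≡x′ : x ≡ x′
      x≡x′ = toℕ-injective (m+m≡n+n⇒m≡n row)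
      cancel-row : ∀ {c c′} → toℕ x + c ≡ toℕ x′ + c′ → c ≡ c′
      cancel-row {c} {c′} h =
        +-cancelˡ-≡ (toℕ x) c c′ (trans h (cong (λ z → toℕ z + c′) (sym x≡x′)))
      y≡y′ : y ≡ y′
      y≡y′ with pair-↭-inv p | ∣1-∣-fibre (toℕ y) (toℕ y′) (cancel-row eq)
      ... | _               | inj₁ h = toℕ-injective h
      ... | inj₁ (ac , _)   | inj₂ _ = toℕ-injective (cancel-row ac)
      -- Swapped distances give y + y′ = M, mirror images in column 1 give y + y′ = 2; but M is at
      -- least 4.
      ... | inj₂ (ac , _)   | inj₂ h
        with () ← trans (sym h) (trans (cong (_+ toℕ y′) (cancel-row ac)) complement-comm)

    resolvable : HasResolvingMultisetPartition (grid n m) 4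
    resolvable = BipartiteLandmarks.resolvable (grid n m) (≡-dec _≟ᶠ_ _≟ᶠ_) (manhattan n m)
      (manhattan-isDistance n m) (manhattan-self n m) (checkerboard n m) (manhattan-parity n m)
      ℓ (escape-to-row-1 ℓ λ { 0F → refl ; 1F → refl ; 2F → refl })
      (sym (checkerboard-last M-even)) (λ ()) (λ ())
      outside≁Q outside≁R outside-injective

  -- Even number of columns: the last column index `M` is odd.

  module EvenWidth (M-odd : parity M ≡ 1ℙ) where

    ℓ : Fin 3 → Vertex
    ℓ 0F = 0F , last
    ℓ 1F = 0F , 0F
    ℓ 2F = 2F , 0F

    1ℙ≢0ℙ : 1ℙ ≢ 0ℙ
    1ℙ≢0ℙ ()

    not-close : ∀ {a b} k → a ≤ 2 + b → b ≤ 2 + a → ¬ (a ∷ b ∷ [] ↭ 4 + k ∷ 1 ∷ [])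
    not-close k a≤2+b b≤2+a p with pair-↭-inv p
    not-close k (s≤s (s≤s (s≤s ()))) _ p | inj₁ (refl , refl)
    not-close k _ (s≤s (s≤s (s≤s ()))) p | inj₂ (refl , refl)

    -- The distances to `Q` and `R` differ by at most 2, whereas `4 + k` and 1 differ by at least 3.
    -- The form `4 + k` covers both M, the distance from `Q` to `P`, and M + 2, that from `R` to
    -- `P`.
    outside≁ : ∀ v k → ¬ (manhattan n m v (ℓ 1F) ∷ manhattan n m v (ℓ 2F) ∷ [] ↭ 4 + k ∷ 1 ∷ [])
    outside≁ (x , y) k = not-close k
      (≤-trans (+-monoˡ-≤ (toℕ y) (m≤n+∣n-m∣ (toℕ x) 2)) (≤-reflexive (+-assoc 2 ∣ 2 - toℕ x ∣ (toℕ y))))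
      (≤-trans (+-monoˡ-≤ (toℕ y) (∣m-n∣≤m+n 2 (toℕ x))) (≤-reflexive (+-assoc 2 (toℕ x) (toℕ y))))

    outside-injective : ∀ u v → manhattan n m u (ℓ 0F) ≡ manhattan n m v (ℓ 0F) →
      manhattan n m u (ℓ 1F) ∷ manhattan n m u (ℓ 2F) ∷ [] ↭
      manhattan n m v (ℓ 1F) ∷ manhattan n m v (ℓ 2F) ∷ [] → u ≡ v
    outside-injective (x , y) (x′ , y′) eq p = ×-≡,≡→≡ (x≡x′ , y≡y′)
      where
      complement-≡ : toℕ y + from-last y ≡ toℕ y′ + from-last y′
      complement-≡ = trans (from-last-complement y) (sym (from-last-complement y′))
      row : toℕ x ≡ toℕ x′
      -- Adding the distance to `P` to the one to `Q` eliminates the column. If the distances to `Q`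
      -- and `R` are swapped, this yields two equations, one for each vertex.
      row with pair-↭-inv p
      ... | inj₁ (ac , _)   = m+m≡n+n⇒m≡n
        (add-complementary (toℕ x) (toℕ x) (toℕ x′) (toℕ x′) complement-≡ ac eq)
      ... | inj₂ (ac , bc)  = ∣2-∣-swap (toℕ x) (toℕ x′)
        (add-complementary (toℕ x) (toℕ x) ∣ 2 - toℕ x′ ∣ (toℕ x′) complement-≡ ac eq)
        (add-complementary (toℕ x′) (toℕ x′) ∣ 2 - toℕ x ∣ (toℕ x) (sym complement-≡)
          (sym bc) (sym eq))
      x≡x′ : x ≡ x′
      x≡x′ = toℕ-injective row
      from-last-≡ : from-last y ≡ from-last y′
      from-last-≡ = +-cancelˡ-≡ (toℕ x) _ _ (trans eq (cong (_+ from-last y′) (sym row)))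
      y≡y′ : y ≡ y′
      y≡y′ = toℕ-injective (+-cancelʳ-≡ (from-last y) _ _
        (trans complement-≡ (cong (toℕ y′ +_) (sym from-last-≡))))

    resolvable : HasResolvingMultisetPartition (grid n m) 4
    resolvable = BipartiteLandmarks.resolvable (grid n m) (≡-dec _≟ᶠ_ _≟ᶠ_) (manhattan n m)
      (manhattan-isDistance n m) (manhattan-self n m) (checkerboard n m) (manhattan-parity n m)
      ℓ (escape-to-row-1 ℓ λ { 0F → refl ; 1F → refl ; 2F → refl })
      refl (λ eq → 1ℙ≢0ℙ (trans (sym (checkerboard-last M-odd)) eq)) (<⇒≢ (m<n+m _ {2} z<s))
      (λ v _ → outside≁ v _) (λ v _ → outside≁ v _) outside-injective

-- The dimension of the grid, from both parities of the width.

grid-resolvable : ∀ n m → n ≥ 3 → m ≥ 5 → HasResolvingMultisetPartition (grid n m) 4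
grid-resolvable (suc (suc (suc n))) (suc (suc (suc (suc (suc m))))) 
  (s≤s (s≤s (s≤s _))) (s≤s (s≤s (s≤s (s≤s (s≤s _)))))
  with parity (4 + m) in eq
... | 0ℙ = LongGrid.OddWidth.resolvable n m eq
... | 1ℙ = LongGrid.EvenWidth.resolvable n m eq

theorem3p3 : ∀ (n m : ℕ) → n ≥ 3 → m ≥ 5 → IsMpd (grid n m) [ 4 ]
theorem3p3 n m n≥3@(s≤s _) m≥5@(s≤s (s≤s _)) =
  grid-resolvable n m n≥3 m≥5 ,
  LowerBound.resolving⇒4≤ (grid n m) (manhattan n m) (manhattan-isDistance n m)
    {0F , 0F} {0F , 1F} (λ ())
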